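{- Let $G(p)$ be a pointed Brauer tree consisting of a single rooted branch, whose edges are numbered according to the pointed edge numbering by the integers of an interval $[a,\dots,b]$, and let the root be numbered $c$, where $a\le c\le b$. Then the permutation $\sigma$ of $\{a,\dots,b\}$ resulting from Kozakai's algorithm has the form $$\sigma=\pi_L\,(c)\,\pi_R,$$ where $\pi_L$ is a permutation of $a,a+1,\dots,c-2,c-1$ and $\pi_R$ is a permutation of $c+1,c+2,\dots,b-1,b$ (and $(c)$ denotes that $c$ is fixed).
   Context: **Brauer trees.** A Brauer tree with $e$ edges is a finite tree with $e$ edges, embedded in the plane so that the cyclic ordering of the edges at each vertex is counterclockwise, together with a designated exceptional vertex $v_0$ (carrying a multiplicity $m\ge 1$, which plays no role in the combinatorics below). The Brauer star is the tree in which every edge is incident to $v_0$. The distance of a vertex is the number of edges on the path joining it to $v_0$. Each edge has a near end (closer to $v_0$) and a far end. A vertex $u\ne v_0$ has an entering edge, the last edge on the path from $v_0$ to $u$. If $u$ has other edges, its primary edge is the edge next after the entering edge in the counterclockwise order at $u$, and its coprimary edge is the edge immediately before the entering edge. A rooted branch is a branch at $v_0$; its edge incident to $v_0$ is its root. A branch is a leaf if it consists of its root only. **Pointing.** A sector $(i,j)$ at a vertex $u$ is a pair of edges such that $j$ is next after $i$ in the counterclockwise order at $u$ (if $u$ has only one edge $i$, the only sector is $(i,i)$). A pointing $p$ is the choice, for each non-exceptional vertex, of one sector at that vertex; this sector is said to contain the point of the vertex. A pointed Brauer tree $G(p)$ is a Brauer tree $G$ with a pointing $p$. The point at the root means the point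 at the far end of the root. **Pointed edge numbering.** A Green's walk is a counterclockwise circuit around the planar tree, starting at $v_0$ and keeping the tree on one's left; thus, on arriving at a vertex $u\neq v_0$ along its entering edge, one next meets the primary edge of $u$. During the walk the non-exceptional vertices are given consecutive numbers $a,a+1,\dots,b$ in the order in which the walk passes through the sectors containing their points, and each edge receives the number of its far end. A reversed Green's walk goes in the opposite direction. **Pointed mutations.** Let $i$ be an edge. The mutation $\mu_i^-$ centered at $i$ is defined as follows. For each end $u$ of $i$ having an edge other than $i$, let $k$ be the edge immediately preceding $i$ in the counterclockwise order at $u$, and let $x$ be the other vertex of $k$. Then $i$ is detached from $u$ and reattached at $x$, inserted immediately before $k$ in the counterclockwise order at $x$. If an end of $i$ has no edge other than $i$, that end is left unchanged. All edges keep their names. The points are carried along as follows. (1) At $u$, a point lying in one of the two sectors adjacent to $i$ lies, after removal of $i$, in the merged sector. (2) At $x$, if $g$ is the edge immediately preceding $k$ before the mutation and the point of $x$ lies in $(g,k)$, then after the mutation it lies in $(g,i)$ (if $k$ is the only edge at $x$, then $g=k$). (3) All other points stay in their sectors. The mutation $\mu_i^+$ is the mirror-image dual, using the edges immediately following $i$ instead of those immediately preceding it. **Kozakai's algorithm.** 1. Fix a rooted branch that is not a leaf as initial branch and make it the current branch. 2. If the point at the root of the current branch is not in the sector between the root and the primary edge, set $\epsilon=-$ and walk from the root along successive primary edges until reaching the first vertex whose point is met on this walk, that is, whose point lies in the sector between its entering edge and its primary edge, or which is the end of a leaf. If the point at the root is in the sector between the root and the primary edge, set $\epsilon=+$ and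 walk from the root along successive coprimary edges until reaching the first vertex whose point lies in the sector between its coprimary edge and its entering edge, or which is the end of a leaf. Let $i$ be the entering edge of the vertex reached, and perform the pointed mutation $\mu_i^{\epsilon}$. If the near end of $i$ was the far end of the root, so that the mutation creates two branches at $v_0$, the branch containing $i$ becomes the current branch. 3. Repeat Step 2 as long as the current branch is not a leaf. 4. When the current branch is a leaf, choose as new current branch one which is not a leaf and whose edges belong to the initial branch, and repeat Steps 2 and 3, until all edges from the initial branch are leaves at $v_0$. If the tree is not yet a Brauer star, return to Step 1 to choose a new initial branch. **The permutation.** The edges keep their numbers during the mutations. The edges at $v_0$ are read counterclockwise starting from the sector at $v_0$ just before the root of the initial branch (edges inserted next to an existing branch by mutations do not cross this starting place). If the edges of the final Brauer star read $s_a,s_{a+1},\dots,s_b$ in this order, then $\sigma(i)=s_i$. -}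

module Defs where

open import Data.Integer using (ℤ; +_; -[1+_]; _+_; _-_; _≤_)
open import Data.List using (List; []; _∷_; [_]; _++_; _∷ʳ_; map; applyUpTo; InitLast; _∷ʳ′_; initLast)
open import Data.List.Membership.Propositional using (_∈_)
open import Data.List.Relation.Unary.All using (All)
open import Data.Nat using (ℕ; suc)
open import Data.Product using (_×_)
open import Function.Bundles using (_↔_; Inverse)
open import Relation.Binary.Construct.Closure.ReflexiveTransitive using (Star)
open import Relation.Binary.PropositionalEquality using (_≡_)
open import Relation.Nullary using (¬_)

Edge : Set
Edge = ℤ

-- `branch i ls rs` is the edge i together with everything beyond it as seen
-- from the exceptional vertex v₀.  If u is the far end of i, the other edges
-- at u, read counterclockwise starting after the entering edge i, are
-- ls ++ rs (so the first one is the primary edge of u and the last one the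
-- coprimary edge), and the point of u lies in the sector between ls and rs,
-- i.e. between the last of i ∷ ls and the first of rs ∷ʳ i.  The d + 1 ways of
-- splitting d edges as ls ++ rs correspond to the d + 1 sectors at u.
data Branch : Set where
  branch : (i : Edge) (ls rs : List Branch) → Branch

-- The branches at v₀, read counterclockwise from a fixed starting place in one
-- of the sectors at v₀.  The multiplicity of v₀ plays no role and is left out.
PointedTree : Set
PointedTree = List Branch

root : Branch → Edge
root (branch i _ _) = i

data Leaf : Branch → Set where
  leaf : ∀ {i} → Leaf (branch i [] [])

-- The point lies in the sector between the entering edge and the primary edge
-- (or in the only sector, if there are no other edges).
data PointFirst : Branch → Set where
  pointFirst : ∀ {i rs} → PointFirst (branch i [] rs)

BrauerStar : PointedTree → Set
BrauerStar = All Leaf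

-- The edges in the order in which the Green's walk passes through the points
-- of their far ends.
mutual
  greenWalk : PointedTree → List Edge
  greenWalk []       = []
  greenWalk (B ∷ Bs) = greenBranch B ++ greenWalk Bs

  greenBranch : Branch → List Edge
  greenBranch (branch i ls rs) = greenWalk ls ++ i ∷ greenWalk rs

edges : Branch → List Edge
edges = greenBranch

interval : ℤ → ℤ → List ℤ
interval a b = from (b - a)
  where
  from : ℤ → List ℤ
  from (+ n)    = applyUpTo (λ k → a + + k) (suc n)
  from -[1+ _ ] = []

-- The edges carry the numbers a, …, b of the pointed edge numbering.
Numbered : ℤ → ℤ → PointedTree → Set
Numbered a b T = greenWalk T ≡ interval a b

-- A pointed tree with a hole for a branch.  In `inˡ C k ls₁ ls₂ rs` the hole is
-- at the far end of k, among the edges before the point, between ls₁ and ls₂;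
-- in `inʳ C k ls rs₁ rs₂` it is among the edges after the point.
data Context : Set where
  atv₀ : (ls rs : List Branch) → Context
  inˡ  : (C : Context) (k : Edge) (ls₁ ls₂ rs : List Branch) → Context
  inʳ  : (C : Context) (k : Edge) (ls rs₁ rs₂ : List Branch) → Context

plug : Context → List Branch → PointedTree
plug (atv₀ ls rs)         Bs = ls ++ Bs ++ rs
plug (inˡ C k ls₁ ls₂ rs) Bs = plug C [ branch k (ls₁ ++ Bs ++ ls₂) rs ]
plug (inʳ C k ls rs₁ rs₂) Bs = plug C [ branch k ls (rs₁ ++ Bs ++ rs₂) ]

-- The far end of i is moved, for μ⁻, from u along the coprimary edge k of u to
-- the other vertex x of k.  Seen from i, the edges at x are then k followed by
-- the former edges beyond k, and the entering edge of u becomes k; the two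
-- sectors next to i at u, which are the first and the last one, merge.
moveFar⁻ : Branch → Branch
moveFar⁻ (branch i ls rs) = go ls (initLast ls) (initLast rs)
  where
  go : ∀ {rs} (ls : List Branch) → InitLast ls → InitLast rs → Branch
  go ls _                      (rs ∷ʳ′ branch k xs ys) = branch i (branch k ls rs ∷ xs) ys
  go _  (ls ∷ʳ′ branch k xs ys) []                     = branch i (branch k [] ls ∷ xs) ys
  go _  []                      []                     = branch i [] []

-- Likewise for μ⁺, along the primary edge.
moveFar⁺ : Branch → Branch
moveFar⁺ (branch i (branch k xs ys ∷ ls) rs) = branch i xs (ys ∷ʳ branch k ls rs)
moveFar⁺ (branch i [] (branch k xs ys ∷ rs)) = branch i xs (ys ∷ʳ branch k rs [])
moveFar⁺ (branch i [] [])                    = branch i [] []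

-- Attach B at the far end of the given branch, immediately before (⁻) or after
-- (⁺) its entering edge.
attach⁻ attach⁺ : Branch → Branch → Branch
attach⁻ B (branch k xs ys) = branch k xs (ys ∷ʳ B)
attach⁺ B (branch k xs ys) = branch k (B ∷ xs) ys

-- `moveNear⁻ C B` puts the branch B, which was in the hole of C, in its new
-- place.  The edge preceding the hole is a sibling, or else the entering edge
-- k, in which case B comes immediately before k at the near end of k.  At v₀
-- the order is cyclic, and nothing moves if the hole is the only place.
moveNear⁻ : Context → Branch → PointedTree
moveNear⁻ (atv₀ ls rs) B = go (initLast ls) (initLast rs)
  where
  go : ∀ {ls′ rs′} → InitLast ls′ → InitLast rs′ → PointedTree
  go (ls′ ∷ʳ′ A) _          = ls′ ++ attach⁻ B A ∷ rs
  go []          (rs′ ∷ʳ′ A) = rs′ ∷ʳ attach⁻ B A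
  go []          []          = [ B ]
moveNear⁻ (inˡ C k ls₁ ls₂ rs) B = go (initLast ls₁)
  where
  go : ∀ {ls} → InitLast ls → PointedTree
  go (ls ∷ʳ′ A) = plug C [ branch k (ls ++ attach⁻ B A ∷ ls₂) rs ]
  go []         = plug C (B ∷ branch k ls₂ rs ∷ [])
moveNear⁻ (inʳ C k ls rs₁ rs₂) B = go (initLast ls) (initLast rs₁)
  where
  go : ∀ {ls′ rs′} → InitLast ls′ → InitLast rs′ → PointedTree
  go _           (rs′ ∷ʳ′ A) = plug C [ branch k ls (rs′ ++ attach⁻ B A ∷ rs₂) ]
  go (ls′ ∷ʳ′ A) []          = plug C [ branch k (ls′ ∷ʳ attach⁻ B A) rs₂ ]
  go []          []          = plug C (B ∷ branch k [] rs₂ ∷ [])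

moveNear⁺ : Context → Branch → PointedTree
moveNear⁺ (atv₀ ls (A ∷ rs))         B = ls ++ attach⁺ B A ∷ rs
moveNear⁺ (atv₀ (A ∷ ls) [])         B = attach⁺ B A ∷ ls
moveNear⁺ (atv₀ [] [])               B = [ B ]
moveNear⁺ (inˡ C k ls₁ (A ∷ ls₂) rs) B = plug C [ branch k (ls₁ ++ attach⁺ B A ∷ ls₂) rs ]
moveNear⁺ (inˡ C k ls₁ [] (A ∷ rs))  B = plug C [ branch k ls₁ (attach⁺ B A ∷ rs) ]
moveNear⁺ (inˡ C k ls₁ [] [])        B = plug C (branch k ls₁ [] ∷ B ∷ [])
moveNear⁺ (inʳ C k ls rs₁ (A ∷ rs₂)) B = plug C [ branch k ls (rs₁ ++ attach⁺ B A ∷ rs₂) ]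
moveNear⁺ (inʳ C k ls rs₁ [])        B = plug C (branch k ls rs₁ ∷ B ∷ [])

-- The pointed mutations of the tree plug C [ B ] centered at the edge root B.
-- The two ends of that edge lie in different components once it is removed,
-- so they can be moved one after the other.
μ⁻ μ⁺ : Context → Branch → PointedTree
μ⁻ C B = moveNear⁻ C (moveFar⁻ B)
μ⁺ C B = moveNear⁺ C (moveFar⁺ B)

-- `Walk⁻ C B C′ B′`: the walk from the edge root B (at C) along successive
-- primary edges first meets a point at, or ends in, the far end of root B′
-- (at C′).
data Walk⁻ : Context → Branch → Context → Branch → Set where
  stop : ∀ {C i rs} → Walk⁻ C (branch i [] rs) C (branch i [] rs)
  next : ∀ {C i A ls rs C′ B′} →
         Walk⁻ (inˡ C i [] ls rs) A C′ B′ →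
         Walk⁻ C (branch i (A ∷ ls) rs) C′ B′

-- The same along coprimary edges, up to a point lying between the coprimary
-- edge and the entering edge.
data Walk⁺ : Context → Branch → Context → Branch → Set where
  stop : ∀ {C i ls} → Walk⁺ C (branch i ls []) C (branch i ls [])
  next : ∀ {C i A ls rs C′ B′} →
         Walk⁺ (inʳ C i ls rs []) A C′ B′ →
         Walk⁺ C (branch i ls (rs ∷ʳ A)) C′ B′

-- A pointed tree with a distinguished (current) branch at v₀.
record State : Set where
  constructor _⟨_⟩_
  field
    left    : List Branch
    current : Branch
    right   : List Branch

  tree : PointedTree
  tree = left ++ current ∷ right

open State public using (tree)

-- A step of the algorithm while E is the set of edges of the initial branch:
-- a pointed mutation, or the choice of a new current branch.  After a mutation
-- centered at i the current branch is the one containing i; unless the near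
-- end of i was the far end of the root, this is the branch with the same root
-- as before.
data _⊢_⟶_ (E : List Edge) : State → State → Set where
  mutate⁻ : ∀ {L B R C A L′ B′ R′} →
            ¬ Leaf B → ¬ PointFirst B →
            Walk⁻ (atv₀ L R) B C A →
            μ⁻ C A ≡ tree (L′ ⟨ B′ ⟩ R′) → root A ∈ edges B′ →
            E ⊢ L ⟨ B ⟩ R ⟶ (L′ ⟨ B′ ⟩ R′)
  mutate⁺ : ∀ {L B R C A L′ B′ R′} →
            ¬ Leaf B → PointFirst B →
            Walk⁺ (atv₀ L R) B C A →
            μ⁺ C A ≡ tree (L′ ⟨ B′ ⟩ R′) → root A ∈ edges B′ →
            E ⊢ L ⟨ B ⟩ R ⟶ (L′ ⟨ B′ ⟩ R′)
  choose  : ∀ {L B R L′ B′ R′} →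
            Leaf B →
            tree (L ⟨ B ⟩ R) ≡ tree (L′ ⟨ B′ ⟩ R′) →
            ¬ Leaf B′ → All (_∈ E) (edges B′) →
            E ⊢ L ⟨ B ⟩ R ⟶ (L′ ⟨ B′ ⟩ R′)

-- `Kozakai T S`: some run of the algorithm on T, for some choices of the
-- initial and the current branches, ends in the Brauer star S.
data Kozakai : PointedTree → PointedTree → Set where
  finish : ∀ {T} → BrauerStar T → Kozakai T T
  round  : ∀ {L B R s S} →
           ¬ Leaf B →
           Star (edges B ⊢_⟶_) (L ⟨ B ⟩ R) s →
           All (λ i → branch i [] [] ∈ tree s) (edges B) →
           Kozakai (tree s) S →
           Kozakai (tree (L ⟨ B ⟩ R)) S

-- A permutation of {a, …, b}, extended by the identity to all of ℤ; for b < a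
-- this is the identity.
record Permutation (a b : ℤ) : Set where
  field
    bijection : ℤ ↔ ℤ
    fixes     : ∀ z → ¬ (a ≤ z × z ≤ b) → Inverse.to bijection z ≡ z

  perm : ℤ → ℤ
  perm = Inverse.to bijection

open Permutation public using (perm)

-- The edges at v₀ of the star S, read counterclockwise from the starting
-- place, are σ(a), …, σ(b).
Reads : ∀ {a b} → PointedTree → Permutation a b → Set
Reads {a} {b} S σ = map root S ≡ map (perm σ) (interval a b)

{-# OPTIONS --safe #-}
-- No mutation performed by the algorithm detaches the root r of the current
-- branch.  While the point at r is not first, only edges before the point move,
-- and a branch created at v₀ lies before r; while it is first, only edges after
-- it move, and a new branch lies after r.  So c stays at v₀ with the edges
-- a, …, c − 1 before it and c + 1, …, b after it in the order of the Green's
-- walk, and in a Brauer star the walk just reads the edges at v₀.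
module Submission where

open import Defs
open import Data.Integer using (ℤ; +_; -[1+_]; +≤+; +<+; _+_; _-_; _≤_; _<_; 1ℤ)
import Data.Integer.Properties as ℤ
open import Data.List using (List; []; _∷_; [_]; _++_; _∷ʳ_; map; _∷ʳ′_; initLast)
open import Data.List.Membership.Propositional using (_∈_; _∉_)
open import Data.List.Properties using (++-assoc; ++-identityʳ; ∷-injective; map-++; map-∘; map-id; map-id-local; map-cong-local)
open import Data.List.Relation.Binary.Permutation.Propositional using (_↭_; refl; prep; swap; trans; ↭-refl; ↭-sym; ↭-trans; ↭⇒↭ₛ)
open import Data.List.Relation.Binary.Permutation.Propositional.Properties using (∈-resp-↭; ++⁺; ++⁺ʳ; ++-commutativeMonoid; All-resp-↭)
import Data.List.Relation.Binary.Permutation.Setoid.Properties as Permutationₛ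
open import Data.List.Relation.Unary.All as All using (All; []; _∷_)
import Data.List.Relation.Unary.All.Properties as All
open import Data.List.Relation.Unary.AllPairs as AllPairs using (AllPairs; []; _∷_)
import Data.List.Relation.Unary.AllPairs.Properties as AllPairs
open import Data.List.Relation.Unary.Any using (here; there)
open import Data.List.Relation.Unary.Unique.Propositional using (Unique)
import Data.Nat as ℕ
open import Data.Product using (Σ-syntax; ∃-syntax; _×_; _,_)
open import Data.Sum using (_⊎_; inj₁; inj₂)
open import Function using (_∘_; _↔_; Inverse; mk↔ₛ′)
open import Function.Construct.Composition using (_↔-∘_)
open import Function.Construct.Identity using (↔-id)
open import Relation.Binary.Construct.Closure.ReflexiveTransitive using (Star; ε; _◅_)
open import Relation.Binary.Definitions using (DecidableEquality)
open import Relation.Binary.PropositionalEquality as ≡ using (_≡_; _≢_; _≗_; cong; cong₂; subst; module ≡-Reasoning)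
open import Relation.Nullary using (¬_; Dec; yes; no; contradiction)
open import Algebra.Solver.CommutativeMonoid (++-commutativeMonoid {A = ℤ}) using (solve; _⊜_; _⊕_; id)

-- Branches compared by their edges.

greenWalk-++ : ∀ As Bs → greenWalk (As ++ Bs) ≡ greenWalk As ++ greenWalk Bs
greenWalk-++ []       Bs = ≡.refl
greenWalk-++ (A ∷ As) Bs =
  ≡.trans (cong (greenBranch A ++_) (greenWalk-++ As Bs))
          (≡.sym (++-assoc (greenBranch A) (greenWalk As) (greenWalk Bs)))

-- A record, so that As and Bs can be inferred from the type.
record _∼_ (As Bs : List Branch) : Set where
  constructor sameEdges
  field
    walk↭ : greenWalk As ↭ greenWalk Bs

open _∼_

∼-refl : ∀ {As} → As ∼ As
∼-refl = sameEdges ↭-refl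

∼-trans : ∀ {As Bs Cs} → As ∼ Bs → Bs ∼ Cs → As ∼ Cs
∼-trans (sameEdges p) (sameEdges q) = sameEdges (↭-trans p q)

∼-reflexive : ∀ {As Bs} → As ≡ Bs → As ∼ Bs
∼-reflexive ≡.refl = ∼-refl

∼-++⁺ : ∀ {As As′ Bs Bs′} → As ∼ As′ → Bs ∼ Bs′ → (As ++ Bs) ∼ (As′ ++ Bs′)
∼-++⁺ {As} {As′} {Bs} {Bs′} (sameEdges p) (sameEdges q) = sameEdges walk
  where
  walk : greenWalk (As ++ Bs) ↭ greenWalk (As′ ++ Bs′)
  walk rewrite greenWalk-++ As Bs | greenWalk-++ As′ Bs′ = ++⁺ p q

∼-++⁺ˡ : ∀ As {Bs Bs′} → Bs ∼ Bs′ → (As ++ Bs) ∼ (As ++ Bs′)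
∼-++⁺ˡ As = ∼-++⁺ (∼-refl {As})

∼-++⁺ʳ : ∀ {As As′} Bs → As ∼ As′ → (As ++ Bs) ∼ (As′ ++ Bs)
∼-++⁺ʳ Bs p = ∼-++⁺ p (∼-refl {Bs})

∼-++-identityʳ : ∀ As → (As ++ []) ∼ As
∼-++-identityʳ As = ∼-reflexive (++-identityʳ As)

-- `Walk⁻` stops only where no edge precedes the point, hence the empty list. The order of the walk
-- may change, as `k` passes from after `i` to before it, so no more than a rearrangement can be
-- claimed.
moveFar⁻-∼ : ∀ i rs → [ moveFar⁻ (branch i [] rs) ] ∼ [ branch i [] rs ]
moveFar⁻-∼ i rs = sameEdges (++⁺ʳ [] walk)
  where
  walk : greenBranch (moveFar⁻ (branch i [] rs)) ↭ greenBranch (branch i [] rs)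
  walk with initLast rs
  ... | []                 = ↭-refl
  ... | rs′ ∷ʳ′ branch k xs ys rewrite greenWalk-++ rs′ [ branch k xs ys ] =
    solve 5 (λ i k r x y → ((k ⊕ r) ⊕ x) ⊕ i ⊕ y ⊜ i ⊕ r ⊕ (x ⊕ k ⊕ y) ⊕ id)
      ↭-refl [ i ] [ k ] (greenWalk rs′) (greenWalk xs) (greenWalk ys)

moveFar⁺-∼ : ∀ i ls → [ moveFar⁺ (branch i ls []) ] ∼ [ branch i ls [] ]
moveFar⁺-∼ i ls = sameEdges (++⁺ʳ [] (walk ls))
  where
  walk : ∀ ls → greenBranch (moveFar⁺ (branch i ls [])) ↭ greenBranch (branch i ls [])
  walk []                    = ↭-refl
  walk (branch k xs ys ∷ ls) rewrite greenWalk-++ ys [ branch k ls [] ] =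
    solve 5 (λ i k l x y → x ⊕ i ⊕ y ⊕ (l ⊕ k) ⊕ id ⊜ ((x ⊕ k ⊕ y) ⊕ l) ⊕ i)
      ↭-refl [ i ] [ k ] (greenWalk ls) (greenWalk xs) (greenWalk ys)

-- Keeping the root at v₀ and the two sides apart.

-- `B ↝ Bs`: in Bs the root of B is still at v₀, and each other edge of B is on
-- the same side of it in the Green's walk as before.
data _↝_ : Branch → List Branch → Set where
  splits : ∀ {i ls rs} Ls ls′ rs′ Rs →
           (Ls ++ ls′) ∼ ls → (rs′ ++ Rs) ∼ rs →
           branch i ls rs ↝ (Ls ++ branch i ls′ rs′ ∷ Rs)

↝-refl : ∀ {B} → B ↝ [ B ]
↝-refl {branch i ls rs} = splits [] ls rs [] ∼-refl (∼-++-identityʳ rs)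

↝⇒∼ : ∀ {B Bs} → B ↝ Bs → Bs ∼ [ B ]
↝⇒∼ (splits {i} {ls} {rs} Ls ls′ rs′ Rs p q) = sameEdges walk
  where
  walk : greenWalk (Ls ++ branch i ls′ rs′ ∷ Rs) ↭ greenWalk [ branch i ls rs ]
  -- The two rearrangements are abstracted so that the rewrites reach their types as well.
  walk with walk↭ p | walk↭ q
  ... | p | q
    rewrite greenWalk-++ Ls (branch i ls′ rs′ ∷ Rs) | greenWalk-++ Ls ls′ | greenWalk-++ rs′ Rs
          | ++-identityʳ (greenWalk ls ++ i ∷ greenWalk rs) =
    ↭-trans
      (solve 5 (λ i L l r R → L ⊕ (l ⊕ i ⊕ r) ⊕ R ⊜ (L ⊕ l) ⊕ i ⊕ (r ⊕ R))
        ↭-refl [ i ] (greenWalk Ls) (greenWalk ls′) (greenWalk rs′) (greenWalk Rs))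
      (++⁺ p (prep i q))

module _ {a} {A : Set a} where

  -- This locates the mutated branch relative to the one that keeps the root: at the same place, to
  -- its right, or to its left.
  ++-∷-split : ∀ (xs : List A) {x ys} us {u vs} → xs ++ x ∷ ys ≡ us ++ u ∷ vs →
               (xs ≡ us × x ≡ u × ys ≡ vs) ⊎
               (∃[ ws ] us ≡ xs ++ x ∷ ws × ys ≡ ws ++ u ∷ vs) ⊎
               (∃[ ws ] xs ≡ us ++ u ∷ ws × vs ≡ ws ++ x ∷ ys)
  ++-∷-split []       []       eq with ∷-injective eq
  ... | p , q = inj₁ (≡.refl , p , q)
  ++-∷-split []       (_ ∷ us) ≡.refl = inj₂ (inj₁ (us , ≡.refl , ≡.refl))
  ++-∷-split (_ ∷ xs) []       ≡.refl = inj₂ (inj₂ (xs , ≡.refl , ≡.refl))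
  ++-∷-split (z ∷ xs) (_ ∷ us) eq with ∷-injective eq
  ... | ≡.refl , eq′ with ++-∷-split xs us eq′
  ...   | inj₁ (p , q)              = inj₁ (cong (z ∷_) p , q)
  ...   | inj₂ (inj₁ (ws , p , q)) = inj₂ (inj₁ (ws , cong (z ∷_) p , q))
  ...   | inj₂ (inj₂ (ws , p , q)) = inj₂ (inj₂ (ws , cong (z ∷_) p , q))

-- If `B` carries the root of `K`, the outer pieces of both splittings are joined. Otherwise all of
-- `B` lies on one side of that root, where only the edges count and `↝⇒∼` suffices. An equation
-- ties `T` to `L ++ B ∷ R`, because matching on `splits` could not unify two concatenations.
↝-trans : ∀ {K T} L {B} R {Bs} → K ↝ T → T ≡ L ++ B ∷ R → B ↝ Bs → K ↝ (L ++ Bs ++ R)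
↝-trans L R (splits Ls _ _ _ _ _) eq B↝Bs with ++-∷-split Ls L eq
↝-trans L R (splits {i} .L _ _ .R p q) _ (splits Ls ls rs Rs p′ q′)
  | inj₁ (≡.refl , ≡.refl , ≡.refl) = subst (branch i _ _ ↝_) assoc
  (splits (L ++ Ls) ls rs (Rs ++ R)
    (∼-trans (∼-reflexive (++-assoc L Ls ls)) (∼-trans (∼-++⁺ˡ L p′) p))
    (∼-trans (∼-reflexive (≡.sym (++-assoc rs Rs R))) (∼-trans (∼-++⁺ʳ R q′) q)))
  where
  assoc : (L ++ Ls) ++ branch i ls rs ∷ Rs ++ R ≡ L ++ (Ls ++ branch i ls rs ∷ Rs) ++ R
  assoc = ≡.trans (++-assoc L Ls _) (cong (L ++_) (≡.sym (++-assoc Ls _ R)))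
↝-trans _ R {Bs} (splits {i} Ls ls rs _ p q) _ B↝Bs
  | inj₂ (inj₁ (M , ≡.refl , ≡.refl)) = subst (branch i _ _ ↝_) (≡.sym (++-assoc Ls _ (Bs ++ R)))
  (splits Ls ls rs (M ++ Bs ++ R) p
    (∼-trans (∼-++⁺ˡ rs (∼-++⁺ˡ M (∼-++⁺ʳ R (↝⇒∼ B↝Bs)))) q))
↝-trans L _ {Bs} (splits {i} _ ls rs Rs p q) _ B↝Bs
  | inj₂ (inj₂ (M , ≡.refl , ≡.refl)) = subst (branch i _ _ ↝_) assoc
  (splits (L ++ Bs ++ M) ls rs Rs
    (∼-trans (∼-++⁺ʳ ls (∼-++⁺ˡ L (∼-++⁺ʳ M (↝⇒∼ B↝Bs)))) p) q)
  where
  assoc : (L ++ Bs ++ M) ++ branch i ls rs ∷ Rs ≡ L ++ Bs ++ M ++ branch i ls rs ∷ Rs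
  assoc = ≡.trans (++-assoc L _ _) (cong (L ++_) (++-assoc Bs M _))

-- The mutations performed by the algorithm.

-- A primary edge has no sibling before it, so at its near end it is preceded by the entering edge.
-- Hence the centre moves to just before `k` if the walk stops at `A`, and otherwise stays beyond
-- `k`.
μ⁻-walk : ∀ {C k A ls rs C′ A′} → Walk⁻ (inˡ C k [] ls rs) A C′ A′ →
          ∃[ Ls ] ∃[ ls′ ] μ⁻ C′ A′ ≡ plug C (Ls ++ [ branch k ls′ rs ]) × (Ls ++ ls′) ∼ (A ∷ ls)
μ⁻-walk {ls = ls} (stop {i = i} {rs = rs}) =
  [ moveFar⁻ (branch i [] rs) ] , ls , ≡.refl , ∼-++⁺ʳ ls (moveFar⁻-∼ i rs)
μ⁻-walk {ls = ls} (next {i = i} {rs = rs} w) with μ⁻-walk w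
... | Ls , ls′ , eq , p =
  -- What leaves the far end of `i` lands at the far end of `k`, so nothing passes `k` itself.
  [] , (Ls ++ [ branch i ls′ rs ]) ++ ls , eq ,
  ∼-++⁺ʳ ls (↝⇒∼ (splits Ls ls′ rs [] p (∼-++-identityʳ rs)))

μ⁺-walk : ∀ {C k A ls rs C′ A′} → Walk⁺ (inʳ C k ls rs []) A C′ A′ →
          ∃[ rs′ ] ∃[ Rs ] μ⁺ C′ A′ ≡ plug C (branch k ls rs′ ∷ Rs) × (rs′ ++ Rs) ∼ (rs ∷ʳ A)
μ⁺-walk {rs = rs} (stop {i = i} {ls = ls}) =
  rs , [ moveFar⁺ (branch i ls []) ] , ≡.refl , ∼-++⁺ˡ rs (moveFar⁺-∼ i ls)
μ⁺-walk {rs = rs} (next {i = i} {ls = ls} w) with μ⁺-walk w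
... | rs′ , Rs , eq , p =
  -- The final `++ []` is the empty list of siblings after the hole, just as `plug` computes it, so
  -- `eq` fits without transport.
  rs ++ (branch i ls rs′ ∷ Rs) ++ [] , [] , eq ,
  ∼-trans (∼-++-identityʳ _)
    (∼-++⁺ˡ rs (∼-trans (∼-++-identityʳ _) (↝⇒∼ (splits [] ls rs′ Rs ∼-refl p))))

-- The point at the root is not first, so the walk takes at least one step and the centre is not the
-- root.
μ⁻-↝ : ∀ {L B R C A} → ¬ PointFirst B → Walk⁻ (atv₀ L R) B C A →
       ∃[ Bs ] B ↝ Bs × μ⁻ C A ≡ L ++ Bs ++ R
μ⁻-↝ ¬first stop     = contradiction pointFirst ¬first
μ⁻-↝ ¬first (next {rs = rs} w) with μ⁻-walk w
... | Ls , ls′ , eq , p = _ , splits Ls ls′ rs [] p (∼-++-identityʳ rs) , eq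

μ⁺-↝ : ∀ {L B R C A} → ¬ Leaf B → PointFirst B → Walk⁺ (atv₀ L R) B C A →
       ∃[ Bs ] B ↝ Bs × μ⁺ C A ≡ L ++ Bs ++ R
-- Stopping at once makes the point last as well as first, which leaves no other edges.
μ⁺-↝ ¬leaf pointFirst stop     = contradiction leaf ¬leaf
μ⁺-↝ ¬leaf pointFirst (next w) with μ⁺-walk w
... | rs′ , Rs , eq , p = _ , splits [] [] rs′ Rs ∼-refl p , eq

-- Runs of the algorithm.

-- `K` stands for the branch given at the outset, which stays the same through all rounds; `↝-trans`
-- carries over to it what happens to the current branch.
↝-step : ∀ {K E s t} → E ⊢ s ⟶ t → K ↝ tree s → K ↝ tree t
↝-step (mutate⁻ {L} {R = R} _ ¬first w eq _) K↝ with μ⁻-↝ ¬first w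
... | _ , B↝Bs , eq′ = subst (_ ↝_) (≡.trans (≡.sym eq′) eq) (↝-trans L R K↝ ≡.refl B↝Bs)
↝-step (mutate⁺ {L} {R = R} ¬leaf first w eq _) K↝ with μ⁺-↝ ¬leaf first w
... | _ , B↝Bs , eq′ = subst (_ ↝_) (≡.trans (≡.sym eq′) eq) (↝-trans L R K↝ ≡.refl B↝Bs)
↝-step (choose _ eq _ _) K↝ = subst (_ ↝_) eq K↝

↝-steps : ∀ {K E s t} → Star (E ⊢_⟶_) s t → K ↝ tree s → K ↝ tree t
↝-steps ε              = λ K↝ → K↝
↝-steps (step ◅ steps) = ↝-steps steps ∘ ↝-step step

↝-Kozakai : ∀ {K T S} → Kozakai T S → K ↝ T → K ↝ S × BrauerStar S
↝-Kozakai (finish star)         K↝ = K↝ , star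
↝-Kozakai (round _ steps _ run) K↝ = ↝-Kozakai run (↝-steps steps K↝)

star-greenWalk : ∀ {S} → BrauerStar S → greenWalk S ≡ map root S
star-greenWalk []                  = ≡.refl
star-greenWalk (leaf {i} ∷ leaves) = cong (i ∷_) (star-greenWalk leaves)

-- In a star the branch still rooted at `c` is a leaf, so all edges once beyond `c` have moved out
-- to v₀, each on its own side.
star-↝ : ∀ {c ls rs S} → branch c ls rs ↝ S → BrauerStar S →
         ∃[ xs ] ∃[ ys ] map root S ≡ xs ++ c ∷ ys × xs ↭ greenWalk ls × ys ↭ greenWalk rs
star-↝ (splits Ls ls′ rs′ Rs p q) leaves with All.++⁻ʳ Ls leaves
star-↝ {c} (splits Ls [] [] Rs p q) leaves | leaf ∷ _ =
  greenWalk Ls , greenWalk Rs ,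
  ≡.trans (≡.sym (star-greenWalk leaves)) (greenWalk-++ Ls (branch c [] [] ∷ Rs)) ,
  walk↭ (∼-trans (∼-reflexive (≡.sym (++-identityʳ Ls))) p) , walk↭ q

-- Permutations from rearrangements of sorted lists.

module _ {a} {A : Set a} (_≟_ : DecidableEquality A) where

  transposition : A → A → A → A
  transposition x y z with z ≟ x | z ≟ y
  ... | yes _ | _     = y
  ... | no  _ | yes _ = x
  ... | no  _ | no  _ = z

  transposition-fst : ∀ x y → transposition x y x ≡ y
  transposition-fst x y with x ≟ x
  ... | yes _  = ≡.refl
  ... | no x≢x = contradiction ≡.refl x≢x

  transposition-snd : ∀ x y → transposition x y y ≡ x
  transposition-snd x y with y ≟ x | y ≟ y
  ... | yes y≡x | _      = y≡x
  ... | no  _   | yes _  = ≡.refl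
  ... | no  _   | no y≢y = contradiction ≡.refl y≢y

  transposition-other : ∀ {x y z} → z ≢ x → z ≢ y → transposition x y z ≡ z
  transposition-other {x} {y} {z} z≢x z≢y with z ≟ x | z ≟ y
  ... | yes z≡x | _       = contradiction z≡x z≢x
  ... | no  _   | yes z≡y = contradiction z≡y z≢y
  ... | no  _   | no  _   = ≡.refl

  transposition-involutive : ∀ x y z → transposition x y (transposition x y z) ≡ z
  transposition-involutive x y z = by-cases (z ≟ x) (z ≟ y)
    where
    by-cases : Dec (z ≡ x) → Dec (z ≡ y) → transposition x y (transposition x y z) ≡ z
    by-cases (yes ≡.refl) _ = ≡.trans (cong (transposition x y) (transposition-fst x y)) (transposition-snd x y)
    by-cases _ (yes ≡.refl) = ≡.trans (cong (transposition x y) (transposition-snd x y)) (transposition-fst x y)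
    by-cases (no z≢x) (no z≢y) =
      ≡.trans (cong (transposition x y) (transposition-other z≢x z≢y)) (transposition-other z≢x z≢y)

  transposition-↔ : A → A → A ↔ A
  transposition-↔ x y = mk↔ₛ′ (transposition x y) (transposition x y)
    (transposition-involutive x y) (transposition-involutive x y)

  -- Fixing everything outside `xs` is what makes the induction work: by uniqueness the head
  -- elements lie outside the tail, so the bijection obtained for the tail leaves them in place.
  ↭⇒↔ : ∀ {xs ys} → Unique xs → xs ↭ ys →
        Σ[ σ ∈ A ↔ A ] map (Inverse.to σ) xs ≡ ys × (∀ z → z ∉ xs → Inverse.to σ z ≡ z)
  ↭⇒↔ u refl = ↔-id A , map-id _ , λ _ _ → ≡.refl
  ↭⇒↔ (x∉xs ∷ u) (prep x p) with ↭⇒↔ u p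
  ... | σ , σ-map , σ-fix =
    σ , cong₂ _∷_ (σ-fix x (λ x∈ → All.lookup x∉xs x∈ ≡.refl)) σ-map , λ z z∉ → σ-fix z (z∉ ∘ there)
  ↭⇒↔ {ys = _ ∷ _ ∷ ys} ((x≢y ∷ x∉xs) ∷ (y∉xs ∷ u)) (swap x y p) with ↭⇒↔ u p
  ... | σ , σ-map , σ-fix =
    transposition-↔ x y ↔-∘ σ ,
    cong₂ _∷_ (≡.trans (cong τ (σ-fix x (λ x∈ → All.lookup x∉xs x∈ ≡.refl))) (transposition-fst x y))
      (cong₂ _∷_ (≡.trans (cong τ (σ-fix y (λ y∈ → All.lookup y∉xs y∈ ≡.refl))) (transposition-snd x y))
        (≡.trans (map-∘ _) (≡.trans (cong (map τ) σ-map) (map-id-local τ-fixes-ys)))) ,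
    λ z z∉ → ≡.trans (cong τ (σ-fix z (z∉ ∘ there ∘ there)))
                     (transposition-other (z∉ ∘ here) (z∉ ∘ there ∘ here))
    where
    τ : A → A
    τ = transposition x y
    τ-fixes-ys : All (λ z → τ z ≡ z) ys
    -- `ys` rearranges the tail of the source list, which by uniqueness avoids `x` and `y`.
    τ-fixes-ys = All-resp-↭ p
      (All.zipWith (λ (x≢z , y≢z) → transposition-other (x≢z ∘ ≡.sym) (y≢z ∘ ≡.sym)) (x∉xs , y∉xs))
  ↭⇒↔ u (trans p q) with ↭⇒↔ u p | ↭⇒↔ (Permutationₛ.Unique-resp-↭ (≡.setoid A) (↭⇒↭ₛ p) u) q
  ... | σ , σ-map , σ-fix | τ , τ-map , τ-fix =
    τ ↔-∘ σ ,
    ≡.trans (map-∘ _) (≡.trans (cong (map (Inverse.to τ)) σ-map) τ-map) ,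
    λ z z∉ → ≡.trans (cong (Inverse.to τ) (σ-fix z z∉)) (τ-fix z (z∉ ∘ ∈-resp-↭ (↭-sym p)))

module _ {a r} {A : Set a} {R : A → A → Set r} where

  AllPairs-++⁻ : ∀ xs {ys} → AllPairs R (xs ++ ys) →
                 AllPairs R xs × AllPairs R ys × All (λ x → All (R x) ys) xs
  AllPairs-++⁻ []       ps       = [] , ps , []
  AllPairs-++⁻ (x ∷ xs) (p ∷ ps) with AllPairs-++⁻ xs ps
  ... | pxs , pys , pxys = All.++⁻ˡ xs p ∷ pxs , pys , All.++⁻ʳ xs p ∷ pxys

interval-bounds : ∀ a b → All (λ z → a ≤ z × z ≤ b) (interval a b)
interval-bounds a b with b - a in eq
... | -[1+ _ ] = []
... | + n      = All.applyUpTo⁺₁ _ (ℕ.suc n) λ {k} k≤n →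
  ℤ.i≤i+j a (+ k) ,
  subst (a + + k ≤_) (≡.trans (cong (_+_ a) (≡.sym eq)) a+[b-a]≡b)
    (ℤ.+-monoʳ-≤ a (+≤+ (ℕ.s≤s⁻¹ k≤n)))
  where
  a+[b-a]≡b : a + (b - a) ≡ b
  a+[b-a]≡b = ≡.trans (ℤ.+-comm a (b - a))
    (≡.trans (ℤ.+-assoc b _ a) (≡.trans (cong (_+_ b) (ℤ.+-inverseˡ a)) (ℤ.+-identityʳ b)))

interval-sorted : ∀ a b → AllPairs _<_ (interval a b)
interval-sorted a b with b - a
... | -[1+ _ ] = []
... | + n      = AllPairs.applyUpTo⁺₁ _ (ℕ.suc n) λ i<j _ → ℤ.+-monoʳ-< a (+<+ i<j)

-- Fixing everything outside `xs` says more than the field `fixes`; it later shows that the two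
-- factors do not disturb each other's edges.
↭⇒Permutation : ∀ {a b xs ys} → AllPairs _<_ xs → All (λ z → a ≤ z × z ≤ b) xs → xs ↭ ys →
                Σ[ σ ∈ Permutation a b ] map (perm σ) xs ≡ ys × (∀ z → z ∉ xs → perm σ z ≡ z)
↭⇒Permutation sorted bounds p with ↭⇒↔ ℤ._≟_ (AllPairs.map ℤ.<⇒≢ sorted) p
... | σ , σ-map , σ-fix =
  record { bijection = σ ; fixes = λ z z∉ → σ-fix z (z∉ ∘ All.lookup bounds) } , σ-map , σ-fix

lemma4p1 : (a b c : ℤ) (ls rs : List Branch) → a ≤ c → c ≤ b →
    Numbered a b [ branch c ls rs ] →
    (S : PointedTree) → Kozakai [ branch c ls rs ] S →
    Σ[ σ ∈ Permutation a b ]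
    (Reads S σ ×
    (Σ[ πL ∈ Permutation a (c - 1ℤ) ] Σ[ πR ∈ Permutation (c + 1ℤ) b ]
    (perm σ ≗ perm πL ∘ perm πR)))
lemma4p1 a b c ls rs _ _ numbered S run
  with ↝-Kozakai run ↝-refl
... | K↝S , star with star-↝ K↝S star
... | xs , ys , read , xs↭ , ys↭
  -- The interval increases strictly, so cutting the walk at `c` leaves smaller numbers before it
  -- and larger ones after it.
  with AllPairs-++⁻ (greenWalk ls) sorted | All.++⁻ (greenWalk ls) bounds
  where
  walk : greenWalk ls ++ c ∷ greenWalk rs ≡ interval a b
  walk = ≡.trans (≡.sym (++-identityʳ _)) numbered
  sorted : AllPairs _<_ (greenWalk ls ++ c ∷ greenWalk rs)
  sorted = subst (AllPairs _<_) (≡.sym walk) (interval-sorted a b)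
  bounds : All (λ z → a ≤ z × z ≤ b) (greenWalk ls ++ c ∷ greenWalk rs)
  bounds = subst (All _) (≡.sym walk) (interval-bounds a b)
... | sortedˡ , (c<rs ∷ sortedʳ) , ls<c∷rs | boundsˡ , _ ∷ boundsʳ
  with ↭⇒Permutation {a} {c - 1ℤ} sortedˡ boundsˡ′ (↭-sym xs↭)
     | ↭⇒Permutation {c + 1ℤ} {b} sortedʳ boundsʳ′ (↭-sym ys↭)
  where
  boundsˡ′ : All (λ z → a ≤ z × z ≤ c - 1ℤ) (greenWalk ls)
  boundsˡ′ = All.zipWith
    -- The predecessor of `c` is `-1 + c`, whereas the bound wanted is `c - 1ℤ`.
    (λ {z} ((a≤z , _) , z<) → a≤z , subst (z ≤_) (ℤ.+-comm -[1+ 0 ] c) (ℤ.i<j⇒i≤pred[j] (All.head z<)))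
    (boundsˡ , ls<c∷rs)
  boundsʳ′ : All (λ z → c + 1ℤ ≤ z × z ≤ b) (greenWalk rs)
  boundsʳ′ = All.zipWith
    (λ {z} ((_ , z≤b) , c<z) → subst (_≤ z) (ℤ.+-comm 1ℤ c) (ℤ.i<j⇒suc[i]≤j c<z) , z≤b)
    (boundsʳ , c<rs)
... | πL , πL-map , πL-fix | πR , πR-map , πR-fix = σ , reads , πL , πR , λ _ → ≡.refl
  where
  σ : Permutation a b
  σ = record
    { bijection = Permutation.bijection πL ↔-∘ Permutation.bijection πR
    ; fixes     = λ z z∉ → ≡.trans
        (cong (perm πL) (πR-fix z (z∉ ∘ All.lookup boundsʳ))) (πL-fix z (z∉ ∘ All.lookup boundsˡ))
    }

  c∉ls : c ∉ greenWalk ls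
  c∉ls c∈ = ℤ.<-irrefl ≡.refl (All.head (All.lookup ls<c∷rs c∈))

  c∉rs : c ∉ greenWalk rs
  c∉rs c∈ = ℤ.<-irrefl ≡.refl (All.lookup c<rs c∈)

  disjoint : ∀ {z} → z ∈ greenWalk ls → z ∉ greenWalk rs
  disjoint z∈ls z∈rs = ℤ.<-irrefl ≡.refl (All.lookup (All.tail (All.lookup ls<c∷rs z∈ls)) z∈rs)

  σ-ls : map (perm σ) (greenWalk ls) ≡ xs
  σ-ls = ≡.trans
    (map-cong-local (All.tabulate (λ {z} z∈ → cong (perm πL) (πR-fix z (disjoint z∈))))) πL-map

  σ-c : perm σ c ≡ c
  σ-c = ≡.trans (cong (perm πL) (πR-fix c c∉rs)) (πL-fix c c∉ls)

  σ-rs : map (perm σ) (greenWalk rs) ≡ ys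
  σ-rs = ≡.trans (map-∘ _) (≡.trans (cong (map (perm πL)) πR-map)
    -- `πR` sends the edges after `c` to `ys`, a rearrangement of the same edges, so none of them
    -- lies before `c` and `πL` fixes them all.
    (map-id-local (All.tabulate (λ {z} z∈ → πL-fix z (λ z∈ls → disjoint z∈ls (∈-resp-↭ ys↭ z∈))))))

  reads : Reads S σ
  reads = begin
    map root S                                            ≡⟨ read ⟩
    xs ++ c ∷ ys                                          ≡⟨ cong₂ _++_ σ-ls (cong₂ _∷_ σ-c σ-rs) ⟨
    map (perm σ) (greenWalk ls) ++
      map (perm σ) (c ∷ greenWalk rs)                     ≡⟨ map-++ (perm σ) (greenWalk ls) _ ⟨
    map (perm σ) (greenWalk ls ++ c ∷ greenWalk rs)       ≡⟨ cong (map (perm σ)) (++-identityʳ _) ⟨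
    map (perm σ) (greenWalk [ branch c ls rs ])           ≡⟨ cong (map (perm σ)) numbered ⟩
    map (perm σ) (interval a b)                           ∎
    where open ≡-Reasoning
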